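{- Let $T$ be a splitting tree. Then there is a splitting tree $S \subseteq T$ such that $S \not\rightarrow_{\mathrm{cont}} (\mathbb{SP})^2_2$, i.e. there is a continuous coloring $c \colon [[S]]^2 \to 2$ such that there is no splitting tree $R \subseteq S$ with $c$ constant on $[[R]]^2$.
   Context: A tree is a set $T \subseteq 2^{<\omega}$ closed under initial segments; $[T]$ is its set of infinite branches (a subspace of $2^\omega$), and $[[T]]^2$ is the set of two-element subsets of $[T]$. For $t \in T$, $T \restriction t = \{ s \in T : s \subseteq t \text{ or } t \subseteq s\}$. For $a \subseteq \omega$ and $X \subseteq 2^{\leq \omega}$, $X$ covers $a$ if for every $n \in a$ and $i \in 2$ there is $s \in X$ with $n \in \operatorname{dom}(s)$ and $s(n) = i$. A tree $T \subseteq 2^{<\omega}$ is a splitting tree if for every $t \in T$, $T \restriction t$ covers a cofinite subset of $\omega$; $\mathbb{SP}$ denotes the set of splitting trees. -}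

module Defs where

open import Level using (Level; _⊔_) renaming (suc to lsuc; zero to lzero)
open import Data.Nat using (ℕ; zero; suc; _≤_)
open import Data.Bool using (Bool)
open import Data.List using (List; []; _∷_; _++_)
open import Data.Maybe using (Maybe; just; nothing)
open import Data.Product using (Σ; ∃; ∃-syntax; _×_; _,_; proj₁; proj₂)
open import Data.Sum using (_⊎_)
open import Relation.Binary.PropositionalEquality using (_≡_; _≢_)

Seq : Set
Seq = List Bool

Real : Set
Real = ℕ → Bool

nth : Seq → ℕ → Maybe Bool
nth []       _       = nothing
nth (b ∷ s)  zero    = just b
nth (b ∷ s)  (suc n) = nth s n

_⊑_ : Seq → Seq → Set
s ⊑ t = ∃[ u ] (t ≡ s ++ u)

SeqSet : Set₁
SeqSet = Seq → Set

record IsTree (T : SeqSet) : Set where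
  field
    closed   : ∀ s t → t ⊑ s → T s → T t
    nonempty : T []

_↾_ : Real → ℕ → Seq
x ↾ zero  = []
x ↾ suc n = x zero ∷ ((λ k → x (suc k)) ↾ n)

_∈[_] : Real → SeqSet → Set
x ∈[ T ] = ∀ n → T (x ↾ n)

_↾T_ : SeqSet → Seq → SeqSet
(T ↾T t) s = T s × (s ⊑ t ⊎ t ⊑ s)

Covers : (ℕ → Set) → SeqSet → Set
Covers a X = ∀ n → a n → ∀ (i : Bool) → ∃[ s ] (X s × nth s n ≡ just i)

Cofinite : (ℕ → Set) → Set
Cofinite a = ∃[ m ] (∀ n → m ≤ n → a n)

record IsSplitting (T : SeqSet) : Set₁ where
  field
    tree  : IsTree T
    split : ∀ t → T t → Σ (ℕ → Set) (λ a → Cofinite a × Covers a (T ↾T t))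

_⊆_ : SeqSet → SeqSet → Set
R ⊆ S = ∀ s → R s → S s

Apart : Real → Real → Set
Apart x y = ∃[ n ] (x n ≢ y n)

AgreeBelow : ℕ → Real → Real → Set
AgreeBelow N x y = ∀ k → suc k ≤ N → x k ≡ y k

-- An element of [[S]]^2, presented as an ordered pair of distinct branches.
record Pair (S : SeqSet) : Set where
  constructor pair
  field
    fst   : Real
    snd   : Real
    fst∈  : fst ∈[ S ]
    snd∈  : snd ∈[ S ]
    apart : Apart fst snd
open Pair public

swap : ∀ {S} → Pair S → Pair S
swap (pair x y x∈ y∈ (n , d)) = pair y x y∈ x∈ (n , λ e → d (Relation.Binary.PropositionalEquality.sym e))

incl : ∀ {R S} → R ⊆ S → Pair R → Pair S
incl {R} {S} R⊆S (pair x y x∈ y∈ d) = pair x y (λ n → R⊆S _ (x∈ n)) (λ n → R⊆S _ (y∈ n)) d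

-- A coloring of [[S]]^2 into 2: a function on pairs that does not depend on the
-- order of the pair (so it is a function of the unordered set {x,y}).
-- Continuity w.r.t. the subspace topology of [[S]]^2 ⊆ 2^ω × 2^ω (target 2 discrete).
-- (Continuity also forces independence of the membership/apartness proofs.)
record ContColoring (S : SeqSet) : Set where
  field
    col       : Pair S → Bool
    symmetric : ∀ p → col (swap p) ≡ col p
    continuous : ∀ p → ∃[ N ] (∀ q → AgreeBelow N (fst q) (fst p)
                                   → AgreeBelow N (snd q) (snd p)
                                   → col q ≡ col p)
open ContColoring public

Homogeneous : ∀ {S R} → ContColoring S → R ⊆ S → Set
Homogeneous c R⊆S = ∃[ i ] (∀ q → col c (incl R⊆S q) ≡ i)

module Submission where

-- The color of {x , y} is the parity of the block of levels [L i , L (i + 1)) containing the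
-- first difference of x and y.  It suffices that S has the property that each splitting R ⊆ S
-- splits in all late blocks.  This is obtained by letting every branch of S take the value 1 at
-- marked positions at most once per block, up to adjacent marks, where block i has more than
-- 2 · 2 ^ L i marks: covering the marks of block i with the value 1 then needs more branches
-- than there are sequences of length L i, so two of them agree up to L i and differ within
-- block i.  To keep such an S splitting one needs a modulus of covering that depends only on the
-- length of a node; constructively, T is first thinned to a tree that has one.

open import Defs
open import Data.Bool using (Bool; true; false; not)
open import Data.Bool.Properties using (not-¬) renaming (_≟_ to _≟ᵇ_)
open import Data.Empty using (⊥-elim)
open import Data.Fin using (Fin; zero; suc; toℕ; combine)
open import Data.Fin.Properties using (toℕ<n; pigeonhole; combine-injective)
open import Data.List using (List; []; _∷_; _++_; length; take; drop; map; upTo; cartesianProduct; cartesianProductWith)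
open import Data.List.Extrema.Nat using (max; xs≤max)
open import Data.List.Membership.Propositional using (_∈_)
open import Data.List.Membership.Propositional.Properties using (∈-map⁺; ∈-upTo⁺; ∈-cartesianProduct⁺; ∈-cartesianProductWith⁺; ∈-cartesianProductWith⁻)
open import Data.List.Properties using (length-take; ++-identityʳ; take++drop≡id)
open import Data.List.Relation.Unary.All using (lookup)
open import Data.List.Relation.Unary.Any using (here; there)
open import Data.Maybe using (just)
open import Data.Maybe.Properties using (just-injective)
open import Data.Nat using (ℕ; zero; suc; _+_; _*_; _^_; _⊔_; _≤_; _<_; z≤n; s≤s; s≤s⁻¹; _≤?_; _<?_)
open import Data.Nat.Properties
open import Data.Product using (Σ; ∃; ∃-syntax; _×_; _,_; proj₁; proj₂)
open import Data.Sum using (_⊎_; inj₁; inj₂)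
open import Relation.Binary.PropositionalEquality using (_≡_; _≢_; refl; sym; trans; cong; subst)
open import Relation.Nullary using (¬_; yes; no)

-- Increasing sequences and the blocks between consecutive values

module Increasing (r : ℕ → ℕ) (r-step : ∀ j → r j < r (suc j)) where

  mono-≤ : ∀ {i j} → i ≤ j → r i ≤ r j
  mono-≤ {i} {zero} z≤n = ≤-refl
  mono-≤ {i} {suc j} i≤1+j with m≤n⇒m<n∨m≡n i≤1+j
  ... | inj₁ i<1+j = ≤-trans (mono-≤ (s≤s⁻¹ i<1+j)) (<⇒≤ (r-step j))
  ... | inj₂ refl  = ≤-refl

  mono-< : ∀ {i j} → i < j → r i < r j
  mono-< {i} i<j = <-≤-trans (r-step i) (mono-≤ i<j)

  reflect-< : ∀ {i j} → r i < r j → i < j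
  reflect-< ri<rj = ≰⇒> (λ j≤i → <⇒≱ ri<rj (mono-≤ j≤i))

  id≤ : ∀ j → j ≤ r j
  id≤ zero    = z≤n
  id≤ (suc j) = ≤-<-trans (id≤ j) (r-step j)

  InBlock : ℕ → ℕ → Set
  InBlock n j = r j ≤ n × n < r (suc j)

  locate : r 0 ≡ 0 → ∀ n → ∃[ j ] InBlock n j
  locate r0≡0 zero = 0 , ≤-reflexive r0≡0 , ≤-<-trans z≤n (r-step 0)
  locate r0≡0 (suc n) with locate r0≡0 n
  ... | j , rj≤n , n<r with r (suc j) ≤? suc n
  ...   | yes r≤1+n = suc j , r≤1+n , ≤-<-trans n<r (r-step (suc j))
  ...   | no  r≰1+n = j , m≤n⇒m≤1+n rj≤n , ≰⇒> r≰1+n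

  block-unique : ∀ {n i j} → InBlock n i → InBlock n j → i ≡ j
  block-unique (ri≤n , n<ri⁺) (rj≤n , n<rj⁺) =
    ≤-antisym (s≤s⁻¹ (reflect-< (≤-<-trans ri≤n n<rj⁺)))
              (s≤s⁻¹ (reflect-< (≤-<-trans rj≤n n<ri⁺)))

-- Finite sequences and branches

nth⇒< : ∀ s n {b} → nth s n ≡ just b → n < length s
nth⇒< (c ∷ s) zero    _ = s≤s z≤n
nth⇒< (c ∷ s) (suc n) e = s≤s (nth⇒< s n e)

<⇒nth : ∀ s n → n < length s → ∃[ b ] (nth s n ≡ just b)
<⇒nth (c ∷ s) zero    _       = c , refl
<⇒nth (c ∷ s) (suc n) (s≤s p) = <⇒nth s n p

⊑-refl : ∀ s → s ⊑ s
⊑-refl s = [] , sym (++-identityʳ s)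

⊑-nth : ∀ {s t} n {b} → s ⊑ t → nth s n ≡ just b → nth t n ≡ just b
⊑-nth {c ∷ s} zero    (u , refl) e = e
⊑-nth {c ∷ s} (suc n) (u , refl) e = ⊑-nth {s} n (u , refl) e

nth-⊑ : ∀ s t → (∀ n {b} → nth s n ≡ just b → nth t n ≡ just b) → s ⊑ t
nth-⊑ []      t       h = t , refl
nth-⊑ (c ∷ s) []      h with () ← h 0 refl
nth-⊑ (c ∷ s) (d ∷ t) h with h 0 refl | nth-⊑ s t (λ n → h (suc n))
... | refl | u , refl = u , refl

⊑-trans : ∀ {s t u} → s ⊑ t → t ⊑ u → s ⊑ u
⊑-trans {s} {t} {u} p q = nth-⊑ s u (λ n e → ⊑-nth {t} n q (⊑-nth {s} n p e))

⊑-nth⁻ : ∀ {s t} n {b} → s ⊑ t → n < length s → nth t n ≡ just b → nth s n ≡ just b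
⊑-nth⁻ {s} n s⊑t n<s e with <⇒nth s n n<s
... | c , e′ = trans e′ (trans (sym (⊑-nth {s} n s⊑t e′)) e)

⊑-length : ∀ {s t} → s ⊑ t → length s ≤ length t
⊑-length {[]}    _          = z≤n
⊑-length {b ∷ s} (u , refl) = s≤s (⊑-length {s} (u , refl))

⊑-linear : ∀ {s t e} → s ⊑ e → t ⊑ e → length s ≤ length t → s ⊑ t
⊑-linear {s} {t} s⊑e t⊑e |s|≤|t| = nth-⊑ s t (λ n e →
  ⊑-nth⁻ {t} n t⊑e (<-≤-trans (nth⇒< s n e) |s|≤|t|) (⊑-nth {s} n s⊑e e))

⊑-comparable : ∀ {s t} → s ⊑ t ⊎ t ⊑ s → length t ≤ length s → t ⊑ s
⊑-comparable {s} {t} (inj₁ s⊑t) |t|≤|s| = ⊑-linear {t} {s} (⊑-refl t) s⊑t |t|≤|s|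
⊑-comparable         (inj₂ t⊑s) _       = t⊑s

take-⊑ : ∀ n s → take n s ⊑ s
take-⊑ n s = drop n s , sym (take++drop≡id n s)

length-take-≤ : ∀ n (s : Seq) → n ≤ length s → length (take n s) ≡ n
length-take-≤ n s n≤ = trans (length-take n s) (m≤n⇒m⊓n≡m n≤)

⊑-take : ∀ {s t} n → s ⊑ t → length s ≤ n → n ≤ length t → s ⊑ take n t
⊑-take {s} {t} n s⊑t |s|≤n n≤|t| =
  ⊑-linear {s} {take n t} s⊑t (take-⊑ n t) (≤-trans |s|≤n (≤-reflexive (sym (length-take-≤ n t n≤|t|))))

nth-take : ∀ {n t} k {b} → k < n → n ≤ length t → nth t k ≡ just b → nth (take n t) k ≡ just b
nth-take {n} {t} k k<n n≤|t| =
  ⊑-nth⁻ {take n t} k (take-⊑ n t) (<-≤-trans k<n (≤-reflexive (sym (length-take-≤ n t n≤|t|))))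

↾-⊑ : ∀ s x n → (∀ k → k < n → nth s k ≡ just (x k)) → (x ↾ n) ⊑ s
↾-⊑ s       x zero    h = s , refl
↾-⊑ []      x (suc n) h with () ← h 0 (s≤s z≤n)
↾-⊑ (c ∷ s) x (suc n) h with h 0 (s≤s z≤n) | ↾-⊑ s (λ k → x (suc k)) n (λ k p → h (suc k) (s≤s p))
... | refl | u , refl = u , refl

nth-↾ : ∀ x n k → k < n → nth (x ↾ n) k ≡ just (x k)
nth-↾ x (suc n) zero    _       = refl
nth-↾ x (suc n) (suc k) (s≤s p) = nth-↾ (λ k → x (suc k)) n k p

-- Splitting trees

Node : SeqSet → Set
Node T = Σ Seq T

module Splitting {T : SeqSet} (T-split : IsSplitting T) where
  open IsSplitting T-split
  open IsTree tree

  root : Node T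
  root = [] , nonempty

  -- The maximum with `length t` forces a node of `T ↾T t` that is defined at such a position to be
  -- longer than `t`, hence to extend `t`.
  modulus : Node T → ℕ
  modulus (t , t∈) = proj₁ (proj₁ (proj₂ (split t t∈))) ⊔ length t

  cover : ∀ (v : Node T) n b → modulus v ≤ n → ∃[ s ] (T s × proj₁ v ⊑ s × nth s n ≡ just b)
  cover (t , t∈) n b μ≤n with split t t∈
  ... | a , (m , cof) , cov with cov n (cof n (≤-trans (m≤m⊔n m (length t)) μ≤n)) b
  ... | s , (s∈ , comp) , e =
    s , s∈ , ⊑-comparable comp (<⇒≤ (≤-<-trans (≤-trans (m≤n⊔m m (length t)) μ≤n) (nth⇒< s n e))) , e

  abstract
    -- Raising `n` to `n ⊔ modulus v` yields a longer node for every `n`, so `extend` is total; the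
    -- value at `n` is right once `n` is beyond the modulus.
    extension : ∀ (v : Node T) n b → Σ (Node T) λ w → proj₁ v ⊑ proj₁ w ×
      length (proj₁ v) < length (proj₁ w) × (modulus v ≤ n → nth (proj₁ w) n ≡ just b)
    extension v n b with cover v (n ⊔ modulus v) b (m≤n⊔m n _)
    ... | s , s∈ , v⊑s , e = (s , s∈) , v⊑s
        , ≤-<-trans (≤-trans (m≤n⊔m _ (length (proj₁ v))) (m≤n⊔m n (modulus v))) (nth⇒< s _ e)
        , λ μ≤n → subst (λ k → nth s k ≡ just b) (m≥n⇒m⊔n≡m μ≤n) e

  extend : Node T → ℕ → Bool → Node T
  extend v n b = proj₁ (extension v n b)

  extend-⊑ : ∀ v n b → proj₁ v ⊑ proj₁ (extend v n b)
  extend-⊑ v n b = proj₁ (proj₂ (extension v n b))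

  extend-long : ∀ v n b → length (proj₁ v) < length (proj₁ (extend v n b))
  extend-long v n b = proj₁ (proj₂ (proj₂ (extension v n b)))

  extend-nth : ∀ v n b → modulus v ≤ n → nth (proj₁ (extend v n b)) n ≡ just b
  extend-nth v n b = proj₂ (proj₂ (proj₂ (extension v n b)))

  module Branch (v : Node T) where
    node : ℕ → Node T
    node zero    = v
    -- The choice of `0` and `true` is arbitrary: each step only has to lengthen the node.
    node (suc k) = extend (node k) 0 true

    node-long : ∀ k → k ≤ length (proj₁ (node k))
    node-long zero    = z≤n
    node-long (suc k) = ≤-<-trans (node-long k) (extend-long (node k) 0 true)

    node-⊑ : ∀ {j k} → j ≤ k → proj₁ (node j) ⊑ proj₁ (node k)
    node-⊑ {j} {zero} z≤n = ⊑-refl _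
    node-⊑ {j} {suc k} j≤1+k with m≤n⇒m<n∨m≡n j≤1+k
    ... | inj₁ j<1+k = ⊑-trans {proj₁ (node j)} (node-⊑ (s≤s⁻¹ j<1+k)) (extend-⊑ (node k) 0 true)
    ... | inj₂ refl  = ⊑-refl _

    branch : Real
    branch n = proj₁ (<⇒nth (proj₁ (node (suc n))) n (node-long (suc n)))

    branch-node : ∀ n → nth (proj₁ (node (suc n))) n ≡ just (branch n)
    branch-node n = proj₂ (<⇒nth (proj₁ (node (suc n))) n (node-long (suc n)))

    branch∈ : branch ∈[ T ]
    branch∈ n = closed _ _ (↾-⊑ (proj₁ (node n)) branch n below) (proj₂ (node n))
      where
      below : ∀ k → k < n → nth (proj₁ (node n)) k ≡ just (branch k)
      below k k<n = ⊑-nth {proj₁ (node (suc k))} k (node-⊑ k<n) (branch-node k)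

    branch-through : ∀ n {b} → nth (proj₁ v) n ≡ just b → branch n ≡ b
    branch-through n e = just-injective (trans (sym (branch-node n))
      (⊑-nth {proj₁ v} n (node-⊑ {0} {suc n} z≤n) e))

-- Thinning to a tree with a uniform modulus

record Uniform (U : SeqSet) : Set where
  field
    tree    : IsTree U
    f       : ℕ → ℕ
    covered : ∀ s n b → U s → f (length s) ≤ n → ∃[ s′ ] (U s′ × s ⊑ s′ × nth s′ n ≡ just b)

module Thinning {T : SeqSet} (T-split : IsSplitting T) where
  open Splitting T-split

  mutual
    -- Lists keep each level finite, so that one number can exceed all moduli on it. The child for
    -- `(n , b)` serves the demand of value `b` at `n`.
    level : ℕ → List (Node T)
    level zero    = root ∷ []
    level (suc i) = cartesianProductWith (λ v (n , b) → extend v n b) (level i)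
                      (cartesianProduct (upTo (bound i)) (true ∷ false ∷ []))

    -- Each node v of level i has the fixed child extend v 0 true in level (suc i), and that child
    -- does not depend on bound i; so bound i may exceed its modulus, and positions from
    -- bound i on can be left to it.
    bound : ℕ → ℕ
    bound zero    = suc (needed (level zero))
    bound (suc i) = suc (bound i ⊔ needed (level (suc i)))

    needed : List (Node T) → ℕ
    needed vs = max 0 (map (λ v → modulus v ⊔ modulus (extend v 0 true)) vs)

  bound-step : ∀ i → bound i < bound (suc i)
  bound-step i = s≤s (m≤m⊔n (bound i) (needed (level (suc i))))

  open Increasing bound bound-step

  needed<bound : ∀ i → needed (level i) < bound i
  needed<bound zero    = ≤-refl
  needed<bound (suc i) = s≤s (m≤n⊔m (bound i) (needed (level (suc i))))

  needed-≥ : ∀ i {v} → v ∈ level i → modulus v ⊔ modulus (extend v 0 true) < bound i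
  needed-≥ i v∈ = ≤-<-trans (lookup (xs≤max 0 _) (∈-map⁺ _ v∈)) (needed<bound i)

  child∈ : ∀ i {v} n b → v ∈ level i → n < bound i → extend v n b ∈ level (suc i)
  child∈ i n b v∈ n<B = ∈-cartesianProductWith⁺ _ v∈ (∈-cartesianProduct⁺ (∈-upTo⁺ n<B) (both b))
    where
    both : ∀ c → c ∈ (true ∷ false ∷ [])
    both true  = here refl
    both false = there (here refl)

  parent : ∀ i {v} → v ∈ level (suc i) →
    ∃[ u ] (u ∈ level i × proj₁ u ⊑ proj₁ v × length (proj₁ u) < length (proj₁ v))
  parent i v∈ with ∈-cartesianProductWith⁻ _ (level i) _ v∈
  ... | u , (n , b) , u∈ , _ , refl = u , u∈ , extend-⊑ u n b , extend-long u n b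

  level-long : ∀ i {v} → v ∈ level i → i ≤ length (proj₁ v)
  level-long zero    _  = z≤n
  level-long (suc i) v∈ with parent i v∈
  ... | u , u∈ , _ , |u|<|v| = ≤-<-trans (level-long i u∈) |u|<|v|

  U : SeqSet
  U s = ∃[ i ] ∃[ v ] (v ∈ level i × s ⊑ proj₁ v)

  -- Nodes of level `i` have length at least `i`, so while the level number exceeds `length s` the
  -- node above `s` can be replaced by its parent. This lets the modulus depend on `length s` alone.
  low-level : ∀ i s v → v ∈ level i → s ⊑ proj₁ v →
    ∃[ j ] ∃[ w ] (j ≤ length s × w ∈ level j × s ⊑ proj₁ w)
  low-level zero    s v v∈ s⊑v = 0 , v , z≤n , v∈ , s⊑v
  low-level (suc i) s v v∈ s⊑v with suc i ≤? length s
  ... | yes i<|s| = suc i , v , i<|s| , v∈ , s⊑v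
  ... | no  i≮|s| with parent i v∈
  ...   | u , u∈ , u⊑v , _ = low-level i s u u∈
          (⊑-linear {s} s⊑v u⊑v (≤-trans (s≤s⁻¹ (≰⇒> i≮|s|)) (level-long i u∈)))

  -- Here `k` is fuel. If `n` is below `bound i`, a child has the required value; otherwise `n` is
  -- beyond the modulus of the fixed child, and the search continues there.
  level-covered : ∀ k i v n b → v ∈ level i → modulus v ≤ n → n < bound (k + i) →
    ∃[ s ] (U s × proj₁ v ⊑ s × nth s n ≡ just b)
  level-covered k i v n b v∈ μ≤n n<B with n <? bound i
  ... | yes n<Bi = proj₁ w , (suc i , w , child∈ i n b v∈ n<Bi , ⊑-refl _)
                 , extend-⊑ v n b , extend-nth v n b μ≤n
    where w = extend v n b
  level-covered zero i v n b v∈ μ≤n n<B | no n≮Bi = ⊥-elim (n≮Bi n<B)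
  level-covered (suc k) i v n b v∈ μ≤n n<B | no n≮Bi
    with level-covered k (suc i) (extend v 0 true) n b
           (child∈ i 0 true v∈ (≤-<-trans z≤n (needed-≥ i v∈)))
           (≤-trans (≤-trans (m≤n⊔m (modulus v) _) (<⇒≤ (needed-≥ i v∈))) (≮⇒≥ n≮Bi))
           (subst (λ j → n < bound j) (sym (+-suc k i)) n<B)
  ... | s , s∈ , w⊑s , e = s , s∈ , ⊑-trans {proj₁ v} (extend-⊑ v 0 true) w⊑s , e

  U-uniform : Uniform U
  U-uniform = record
    { tree = record
        { closed   = λ s t t⊑s (i , v , v∈ , s⊑v) → i , v , v∈ , ⊑-trans {t} t⊑s s⊑v
        ; nonempty = 0 , root , here refl , ⊑-refl [] }
    ; f = bound
    ; covered = covered′ }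
    where
    covered′ : ∀ s n b → U s → bound (length s) ≤ n → ∃[ s′ ] (U s′ × s ⊑ s′ × nth s′ n ≡ just b)
    covered′ s n b (i , v , v∈ , s⊑v) B≤n with low-level i s v v∈ s⊑v
    -- The fuel `suc n` suffices because `bound` dominates the identity.
    ... | j , w , j≤|s| , w∈ , s⊑w with level-covered (suc n) j w n b w∈
              (≤-trans (≤-trans (m≤m⊔n (modulus w) _) (<⇒≤ (needed-≥ j w∈))) (≤-trans (mono-≤ j≤|s|) B≤n))
              (≤-trans (m≤m+n (suc n) j) (id≤ (suc n + j)))
    ... | s′ , s′∈ , w⊑s′ , e = s′ , s′∈ , ⊑-trans {s} s⊑w w⊑s′ , e

  U⊆T : U ⊆ T
  U⊆T s (i , (v , v∈T) , _ , s⊑v) = IsTree.closed (IsSplitting.tree T-split) v s s⊑v v∈T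

-- Thinning to a tree whose splitting subtrees split in every late block

module Sparsification {U : SeqSet} (U-uniform : Uniform U) where
  open Uniform U-uniform
  open IsTree tree

  -- These are the marked positions. For a node ending right after a mark, the modulus is at most
  -- the next mark, so its value there can be prescribed.
  r : ℕ → ℕ
  r zero    = 0
  r (suc j) = suc (r j) ⊔ f (suc (r j))

  r-step : ∀ j → r j < r (suc j)
  r-step j = m≤m⊔n (suc (r j)) (f (suc (r j)))

  open Increasing r r-step

  -- Twice one more than the number of sequences of length r (J i): two non-adjacent marks of
  -- block i then exceed any choice of one continuation per sequence.
  J : ℕ → ℕ
  J zero    = 0
  J (suc i) = J i + 2 * suc (2 ^ r (J i))

  J-step : ∀ i → J i < J (suc i)
  J-step i = m<m+n (J i) (s≤s z≤n)

  module Jₘ = Increasing J J-step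

  Marked : Seq → ℕ → Set
  Marked e j = nth e (r j) ≡ just true

  -- Adjacent marks are exempt because serving a demand between two marks leaves the values at both
  -- uncontrolled.
  Sparse : Seq → Set
  Sparse e = ∀ i j j′ → J i ≤ j → 2 + j ≤ j′ → j′ < J (suc i) → Marked e j → ¬ Marked e j′

  record Good (j : ℕ) (e : Seq) : Set where
    field
      inU    : U e
      len    : length e ≡ suc (r j)
      sparse : Sparse e
  open Good

  marked-≤ : ∀ j e → length e ≡ suc (r j) → ∀ j′ → Marked e j′ → j′ ≤ j
  marked-≤ j e |e| j′ m =
    s≤s⁻¹ (reflect-< (<-≤-trans (nth⇒< e (r j′) m) (≤-trans (≤-reflexive |e|) (r-step j))))

  marked-restrict : ∀ j e {e′} → length e ≡ suc (r j) → e ⊑ e′ →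
    ∀ j′ → j′ ≤ j → Marked e′ j′ → Marked e j′
  marked-restrict j e |e| e⊑e′ j′ j′≤j m =
    ⊑-nth⁻ {e} (r j′) e⊑e′ (≤-trans (s≤s (mono-≤ j′≤j)) (≤-reflexive (sym |e|))) m

  f≤r : ∀ j (e : Seq) → length e ≡ suc (r j) → f (length e) ≤ r (suc j)
  f≤r j e |e| = subst (λ l → f l ≤ r (suc j)) (sym |e|) (m≤n⊔m (suc (r j)) (f (suc (r j))))

  cut : ∀ n s → U s → U (take n s)
  cut n s s∈ = closed s (take n s) (take-⊑ n s) s∈

  extendTo : ∀ s N → U s → length s ≤ N → ∃[ s′ ] (U s′ × s ⊑ s′ × length s′ ≡ N)
  -- Covering a position from `N` on, with an arbitrary value, serves only to obtain a node longer
  -- than `N`.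
  extendTo s N s∈ |s|≤N with covered s (f (length s) ⊔ N) true s∈ (m≤m⊔n _ N)
  ... | t , t∈ , s⊑t , e =
    take N t , cut N t t∈ , ⊑-take {s} N s⊑t |s|≤N N≤|t| , length-take-≤ N t N≤|t|
    where
    N≤|t| : N ≤ length t
    N≤|t| = <⇒≤ (≤-<-trans (m≤n⊔m _ N) (nth⇒< t _ e))

  covered-exactly : ∀ s n b → U s → f (length s) ≤ n → length s ≤ n →
    ∃[ s′ ] (U s′ × s ⊑ s′ × nth s′ n ≡ just b × length s′ ≡ suc n)
  covered-exactly s n b s∈ f≤n |s|≤n with covered s n b s∈ f≤n
  ... | t , t∈ , s⊑t , e =
    take (suc n) t , cut (suc n) t t∈ , ⊑-take {s} (suc n) s⊑t (m≤n⇒m≤1+n |s|≤n) n<|t|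
    , nth-take {suc n} {t} n ≤-refl n<|t| e , length-take-≤ (suc n) t n<|t|
    where
    n<|t| : n < length t
    n<|t| = nth⇒< t n e

  len≤r : ∀ j (e : Seq) → length e ≡ suc (r j) → length e ≤ r (suc j)
  len≤r j e |e| = ≤-trans (≤-reflexive |e|) (r-step j)

  -- Taking the value `false` at the next mark creates no new pair of marks, so sparsity is
  -- inherited.
  good-step : ∀ {j e} → Good j e → ∃[ e′ ] (Good (suc j) e′ × e ⊑ e′ × ¬ Marked e′ (suc j))
  good-step {j} {e} g
    with covered-exactly e (r (suc j)) false (inU g) (f≤r j e (len g)) (len≤r j e (len g))
  ... | e′ , e′∈ , e⊑e′ , zero′ , |e′| =
    e′ , record { inU = e′∈ ; len = |e′| ; sparse = sparse′ } , e⊑e′ , unmarked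
    where
    unmarked : ¬ Marked e′ (suc j)
    unmarked m with () ← trans (sym zero′) m

    sparse′ : Sparse e′
    sparse′ i j₁ j₂ J≤ gap <J m₁ m₂ with m≤n⇒m<n∨m≡n (marked-≤ (suc j) e′ |e′| j₂ m₂)
    ... | inj₂ refl = unmarked m₂
    ... | inj₁ j₂≤j = sparse g i j₁ j₂ J≤ gap <J
            (marked-restrict j e (len g) e⊑e′ j₁ (≤-trans (≤-trans (m≤n+m j₁ 2) gap) (s≤s⁻¹ j₂≤j)) m₁)
            (marked-restrict j e (len g) e⊑e′ j₂ (s≤s⁻¹ j₂≤j) m₂)

  good-steps : ∀ {j₀ e} → Good j₀ e → ∀ j → j₀ ≤ j →
    ∃[ e′ ] (Good j e′ × e ⊑ e′ × (∀ k → Marked e′ k → k ≤ j₀))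
  good-steps {j₀} {e} g j j₀≤j with m≤n⇒m<n∨m≡n j₀≤j
  ... | inj₂ refl = e , g , ⊑-refl e , marked-≤ j₀ e (len g)
  good-steps {j₀} {e} g (suc j) _ | inj₁ j₀<1+j with good-steps g j (s≤s⁻¹ j₀<1+j)
  ... | e′ , g′ , e⊑e′ , low with good-step g′
  ... | e″ , g″ , e′⊑e″ , unmarked = e″ , g″ , ⊑-trans {e} e⊑e′ e′⊑e″ , low′
    where
    low′ : ∀ k → Marked e″ k → k ≤ j₀
    low′ k m with m≤n⇒m<n∨m≡n (marked-≤ (suc j) e″ (len g″) k m)
    ... | inj₁ k≤j  = low k (marked-restrict j e′ (len g′) e′⊑e″ k (s≤s⁻¹ k≤j) m)
    ... | inj₂ refl = ⊥-elim (unmarked m)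

  -- With `n` in the interval from mark `j + 1` to mark `j + 2`, unmarked steps lead up to mark `j`,
  -- and one jump then reaches `n`. Jumping from mark `j + 1` would be too late: the modulus there
  -- is only known to be at most mark `j + 2`.
  good-cover : ∀ {j₀ e} → Good j₀ e → ∀ i → j₀ < J i → ∀ n b → r (suc (J i)) ≤ n →
    ∃[ j ] ∃[ s ] (Good j s × e ⊑ s × nth s n ≡ just b)
  good-cover {j₀} {e} g i j₀<J n b r≤n with locate refl n
  ... | zero  , _ , n<r1 = ⊥-elim (<⇒≱ n<r1 (≤-trans (mono-≤ {1} {suc (J i)} (s≤s z≤n)) r≤n))
  ... | suc j , rj≤n , n<r with J≤j ← s≤s⁻¹ (s≤s⁻¹ (reflect-< (≤-<-trans r≤n n<r)))
    with good-steps g j (≤-trans (<⇒≤ j₀<J) J≤j)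
  ... | e′ , g′ , e⊑e′ , low
    with covered-exactly e′ n b (inU g′) (≤-trans (f≤r j e′ (len g′)) rj≤n) (≤-trans (len≤r j e′ (len g′)) rj≤n)
  ... | s , s∈ , e′⊑s , sn , |s|
    with extendTo s (suc (r (2 + j))) s∈ (≤-trans (≤-reflexive |s|) (m≤n⇒m≤1+n n<r))
  ... | s′ , s′∈ , s⊑s′ , |s′| =
    2 + j , s′ , record { inU = s′∈ ; len = |s′| ; sparse = sparse′ }
    , ⊑-trans {e} e⊑e′ e′⊑s′ , ⊑-nth {s} n s⊑s′ sn
    where
    e′⊑s′ : e′ ⊑ s′
    e′⊑s′ = ⊑-trans {e′} e′⊑s s⊑s′

    -- Only the marks j + 1 and j + 2 are uncontrolled; they are adjacent, and all other marks
    -- lie in blocks before i.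
    sparse′ : Sparse s′
    sparse′ i′ j₁ j₂ J≤ gap <J m₁ m₂ with marked-restrict j e′ (len g′) e′⊑s′ j₁
                                            (s≤s⁻¹ (s≤s⁻¹ (≤-trans gap (marked-≤ (2 + j) s′ |s′| j₂ m₂)))) m₁
    ... | m₁′ with j₂ ≤? j
    ...   | yes j₂≤j = sparse g′ i′ j₁ j₂ J≤ gap <J m₁′ (marked-restrict j e′ (len g′) e′⊑s′ j₂ j₂≤j m₂)
    ...   | no  j₂≰j = <⇒≱ j₀<J (≤-trans (Jₘ.mono-≤ i≤i′) (≤-trans J≤ (low j₁ m₁′)))
      where
      i≤i′ : i ≤ i′
      i≤i′ = s≤s⁻¹ (Jₘ.reflect-< (≤-<-trans J≤j (<-trans (≰⇒> j₂≰j) <J)))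

  S : SeqSet
  S s = ∃[ j ] ∃[ e ] (Good j e × s ⊑ e)

  S⊆U : S ⊆ U
  S⊆U s (j , e , g , s⊑e) = closed e s s⊑e (inU g)

  S-splitting : IsSplitting S
  S-splitting = record
    { tree = record
        { closed   = λ s t t⊑s (j , e , g , s⊑e) → j , e , g , ⊑-trans {t} t⊑s s⊑e
        ; nonempty = nonempty′ }
    ; split = split′ }
    where
    nonempty′ : S []
    nonempty′ with extendTo [] 1 nonempty z≤n
    ... | e , e∈ , _ , |e| = 0 , e , record { inU = e∈ ; len = |e| ; sparse = sparse′ } , e , refl
      where
      sparse′ : Sparse e
      -- A node of length 1 sees only mark 0, so it has no two marks at distance two.
      sparse′ i j₁ j₂ _ gap _ _ m₂ with () ← ≤-trans gap (marked-≤ 0 e |e| j₂ m₂)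

    split′ : ∀ t → S t → Σ (ℕ → Set) (λ a → Cofinite a × Covers a (S ↾T t))
    split′ t (j₀ , e , g , t⊑e) =
      -- Block `suc j₀` begins after mark `j₀`, the last one that `e` sees.
      (λ n → r (suc (J (suc j₀))) ≤ n) , (r (suc (J (suc j₀))) , λ n p → p) , covers
      where
      covers : Covers (λ n → r (suc (J (suc j₀))) ≤ n) (S ↾T t)
      covers n p b with good-cover g (suc j₀) (Jₘ.id≤ (suc j₀)) n b p
      ... | j , s , g′ , e⊑s , sn =
        s , ((j , s , g′ , ⊑-refl s) , inj₂ (⊑-trans {t} t⊑e e⊑s)) , sn

  branch-sparse : ∀ {x} → x ∈[ S ] → ∀ i j j′ → J i ≤ j → 2 + j ≤ j′ → j′ < J (suc i) →
    x (r j) ≡ true → x (r j′) ≢ true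
  branch-sparse {x} x∈ i j j′ J≤ gap <J xj xj′ with x∈ (suc (r j′))
  ... | k , e , g , x⊑e = sparse g i j j′ J≤ gap <J
          (mark j (s≤s (mono-≤ (≤-trans (m≤n+m j 2) gap))) xj) (mark j′ ≤-refl xj′)
    where
    mark : ∀ l → r l < suc (r j′) → x (r l) ≡ true → Marked e l
    mark l p e′ = ⊑-nth {x ↾ suc (r j′)} (r l) x⊑e (trans (nth-↾ x _ (r l) p) (cong just e′))

-- First differences and the coloring

IsΔ : Real → Real → ℕ → Set
IsΔ x y d = x d ≢ y d × (∀ k → k < d → x k ≡ y k)

Δ-exists : ∀ x y n → x n ≢ y n → ∃[ d ] IsΔ x y d
Δ-exists x y zero    x≢y = 0 , x≢y , λ _ ()
Δ-exists x y (suc n) x≢y with x 0 ≟ᵇ y 0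
... | no  x₀≢y₀ = 0 , x₀≢y₀ , λ _ ()
... | yes x₀≡y₀ with Δ-exists (λ k → x (suc k)) (λ k → y (suc k)) n x≢y
...   | d , neq , eq = suc d , neq , λ { zero _ → x₀≡y₀ ; (suc k) (s≤s p) → eq k p }

Δ-≤ : ∀ {x y d n} → IsΔ x y d → x n ≢ y n → d ≤ n
Δ-≤ (_ , eq) x≢y = ≮⇒≥ (λ n<d → x≢y (eq _ n<d))

Δ-unique : ∀ {x y d d′} → IsΔ x y d → IsΔ x y d′ → d ≡ d′
Δ-unique δ δ′ = ≤-antisym (Δ-≤ δ (proj₁ δ′)) (Δ-≤ δ′ (proj₁ δ))

Δ-sym : ∀ {x y d} → IsΔ x y d → IsΔ y x d
Δ-sym (neq , eq) = (λ e → neq (sym e)) , λ k p → sym (eq k p)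

Δ-cong : ∀ {x y x′ y′ d} → AgreeBelow (suc d) x′ x → AgreeBelow (suc d) y′ y → IsΔ x y d → IsΔ x′ y′ d
Δ-cong {d = d} ax ay (neq , eq) =
  (λ e → neq (trans (sym (ax d ≤-refl)) (trans e (ay d ≤-refl)))) ,
  λ k p → trans (ax k (m≤n⇒m≤1+n p)) (trans (eq k p) (sym (ay k (m≤n⇒m≤1+n p))))

Δ : ∀ {S} → Pair S → ℕ
Δ p = proj₁ (Δ-exists (fst p) (snd p) (proj₁ (apart p)) (proj₂ (apart p)))

Δ-isΔ : ∀ {S} (p : Pair S) → IsΔ (fst p) (snd p) (Δ p)
Δ-isΔ p = proj₂ (Δ-exists (fst p) (snd p) (proj₁ (apart p)) (proj₂ (apart p)))

-- Both laws come from the uniqueness of the first difference, which survives swapping the branches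
-- and changing them beyond it.
Δ-coloring : ∀ {S} → (ℕ → Bool) → ContColoring S
Δ-coloring κ = record
  { col        = λ p → κ (Δ p)
  ; symmetric  = λ p → cong κ (Δ-unique (Δ-sym (Δ-isΔ (swap p))) (Δ-isΔ p))
  ; continuous = λ p → suc (Δ p) , λ q ax ay →
      cong κ (Δ-unique (Δ-isΔ q) (Δ-cong ax ay (Δ-isΔ p))) }

-- Coding initial segments for the pigeonhole principle

bit : Bool → Fin 2
bit false = zero
bit true  = suc zero

bit-injective : ∀ b c → bit b ≡ bit c → b ≡ c
bit-injective false false _ = refl
bit-injective true  true  _ = refl

code : Real → ∀ n → Fin (2 ^ n)
code x zero    = zero
code x (suc n) = combine (bit (x 0)) (code (λ k → x (suc k)) n)

code-injective : ∀ x y n → code x n ≡ code y n → ∀ k → k < n → x k ≡ y k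
code-injective x y (suc n) e k k<1+n
  with combine-injective (bit (x 0)) (code (λ k → x (suc k)) n) (bit (y 0)) (code (λ k → y (suc k)) n) e
code-injective x y (suc n) e zero    _         | e₀ , _  = bit-injective _ _ e₀
code-injective x y (suc n) e (suc k) (s≤s k<n) | _  , e′ = code-injective _ _ n e′ k k<n

-- Coloring by block parity

parity : ℕ → Bool
parity zero    = false
parity (suc n) = not (parity n)

module Coloring {U : SeqSet} (U-uniform : Uniform U) where
  open Sparsification U-uniform
  module rₘ = Increasing r r-step

  L : ℕ → ℕ
  L i = r (J i)

  L-step : ∀ i → L i < L (suc i)
  L-step i = rₘ.mono-< (J-step i)

  open Increasing L L-step using (InBlock; locate; block-unique; id≤)

  κ : ℕ → Bool
  κ d = parity (proj₁ (locate refl d))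

  κ-block : ∀ d i → InBlock d i → κ d ≡ parity i
  κ-block d i b = cong parity (block-unique {d} {proj₁ (locate refl d)} {i} (proj₂ (locate refl d)) b)

  splits-in-block : ∀ {R} → IsSplitting R → R ⊆ S →
    ∃[ m ] (∀ i → m ≤ i → Σ (Pair R) λ q → InBlock (Δ q) i)
  splits-in-block {R} R-split R⊆S = modulus root , splits
    where
    open Splitting R-split

    module _ (i : ℕ) (m≤i : modulus root ≤ i) where
      pos : Fin (suc (2 ^ L i)) → ℕ
      -- Steps of two avoid adjacent marks; `J (suc i)` leaves room for exactly these
      -- `suc (2 ^ L i)` positions.
      pos k = J i + 2 * toℕ k

      v : Fin (suc (2 ^ L i)) → Node R
      v k = extend root (r (pos k)) true

      x : Fin (suc (2 ^ L i)) → Real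
      x k = Branch.branch (v k)

      x∈ : ∀ k → x k ∈[ R ]
      x∈ k = Branch.branch∈ (v k)

      x-marked : ∀ k → x k (r (pos k)) ≡ true
      x-marked k = Branch.branch-through (v k) (r (pos k))
        -- Since `i ≤ L i`, a block whose index is at least the modulus of the root lies beyond that
        -- modulus.
        (extend-nth root _ true (≤-trans m≤i (≤-trans (id≤ i) (rₘ.mono-≤ (m≤m+n (J i) _)))))

      pos<J : ∀ k → pos k < J (suc i)
      pos<J k = +-monoʳ-< (J i) (*-monoʳ-< 2 (toℕ<n k))

      gap : ∀ {k k′} → toℕ k < toℕ k′ → 2 + pos k ≤ pos k′
      gap {k} {k′} k<k′ = begin
        2 + (J i + 2 * toℕ k) ≡⟨ +-assoc-comm (J i) (2 * toℕ k) ⟩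
        J i + (2 + 2 * toℕ k) ≡⟨ cong (J i +_) (sym (*-suc 2 (toℕ k))) ⟩
        J i + 2 * suc (toℕ k) ≤⟨ +-monoʳ-≤ (J i) (*-monoʳ-≤ 2 k<k′) ⟩
        pos k′                ∎
        where
        open ≤-Reasoning
        +-assoc-comm : ∀ a b → 2 + (a + b) ≡ a + (2 + b)
        +-assoc-comm a b = sym (trans (+-suc a (suc b)) (cong suc (+-suc a b)))

      splits : Σ (Pair R) λ q → InBlock (Δ q) i
      -- There is one more branch than there are codes of length `L i`.
      splits with pigeonhole ≤-refl (λ k → code (x k) (L i))
      ... | k , k′ , k<k′ , same = q , L≤Δ , Δ<L
        where
        differ : x k (r (pos k′)) ≢ x k′ (r (pos k′))
        -- Otherwise `x k` would take the value `true` at two non-adjacent marks of block `i`.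
        differ e = branch-sparse (λ n → R⊆S _ (x∈ k n)) i (pos k) (pos k′) (m≤m+n (J i) _) 
                     (gap {k} {k′} k<k′) (pos<J k′) (x-marked k) (trans e (x-marked k′))

        q : Pair R
        q = pair (x k) (x k′) (x∈ k) (x∈ k′) (r (pos k′) , differ)

        L≤Δ : L i ≤ Δ q
        L≤Δ = ≮⇒≥ (λ Δ<L → proj₁ (Δ-isΔ q) (code-injective (x k) (x k′) (L i) same _ Δ<L))

        Δ<L : Δ q < L (suc i)
        Δ<L = ≤-<-trans (Δ-≤ (Δ-isΔ q) differ) (rₘ.mono-< (pos<J k′))

  not-homogeneous : ∀ {R} → IsSplitting R → (R⊆S : R ⊆ S) → ¬ Homogeneous (Δ-coloring κ) R⊆S
  not-homogeneous R-split R⊆S (c , hom) with splits-in-block R-split R⊆S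
  -- The consecutive blocks `m` and `suc m` both contain first differences of pairs from `R`, and
  -- their parities are opposite.
  ... | m , splits = not-¬ (color m ≤-refl) (color (suc m) (n≤1+n m))
    where
    color : ∀ i → m ≤ i → c ≡ parity i
    color i m≤i with splits i m≤i
    ... | q , b = trans (sym (hom q)) (κ-block (Δ q) i b)

theorem3p2 : (T : SeqSet) → IsSplitting T →
    Σ SeqSet (λ S → IsSplitting S × Σ (S ⊆ T) (λ _ →
    Σ (ContColoring S) (λ c →
    ¬ (Σ SeqSet (λ R → IsSplitting R × Σ (R ⊆ S) (λ R⊆S → Homogeneous c R⊆S))))))
theorem3p2 T T-split =
  S , S-splitting , (λ s s∈ → U⊆T s (S⊆U s s∈)) , Δ-coloring κ ,
  λ (R , R-split , R⊆S , hom) → not-homogeneous R-split R⊆S hom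
  where
  open Thinning T-split
  open Sparsification U-uniform
  open Coloring U-uniform
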